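{- Let $D$ be a northeast diagram. Then $\mathcal{P}(D)$ is a refinement of $\mathcal{P}^{ele}(D)$; in particular, $\mathcal{P}(D)$ and $\mathcal{P}^{ele}(D)$ are equal as sets. That is, every diagram that can be obtained from $D$ by a finite sequence of Kohnert moves can also be obtained from $D$ by a finite sequence of elementary Kohnert moves, and every order relation of $\mathcal{P}^{ele}(D)$ is an order relation of $\mathcal{P}(D)$.
   Context: A diagram is a finite subset of $\mathbb{N}\times\mathbb{N}$ ($\mathbb{N}=\{1,2,\dots\}$); an element $(r,c)$ is a cell in row $r$ and column $c$, rows numbered from bottom to top. A position $(r,c)$ is empty if it is not in the diagram. A Kohnert move on a diagram $D$ selects a row $r$, takes the rightmost cell $(r,c)$ of $D$ in that row, and moves it to $(r',c)$, where $r'$ is the largest index $1\le r'<r$ with $(r',c)\notin D$ (if no such $r'$ exists, no move is possible); so the cell may jump over cells of its column. The move is elementary if $r'=r-1$, and a jump move otherwise. The Kohnert poset $\mathcal{P}(D)$ is the set of all diagrams obtainable from $D$ by finitely many Kohnert moves (including $D$), ordered by the transitive closure of $D_2<D_1$ whenever $D_2$ results from $D_1$ by a single Kohnert move. The elementary Kohnert poset $\mathcal{P}^{ele}(D)$ is defined in the same way using only elementary Kohnert moves. A diagram $D$ is northeast if for all cells $(r_1,c_1),(r_2,c_2)\in D$ we have $(\max(r_1,r_2),\max(c_1,c_2))\in D$. -}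

module Defs where

open import Data.Nat using (ℕ; suc; _≤_; _<_; _⊔_)
open import Data.Product using (_×_; _,_; Σ; ∃; ∃-syntax)
open import Data.Sum using (_⊎_)
open import Data.List using (List)
open import Data.List.Membership.Propositional using (_∈_; _∉_)
open import Relation.Binary.PropositionalEquality using (_≡_; _≢_)
open import Relation.Binary.Construct.Closure.ReflexiveTransitive using (Star)
open import Function.Bundles using (_⇔_)

-- A cell (r , c): row r (numbered bottom to top), column c.  Indices are
-- intended to be ≥ 1 (the paper's ℕ = {1,2,...}); see `Positive`.
Cell : Set
Cell = ℕ × ℕ

-- A diagram is a finite set of cells, represented by a list; two lists
-- represent the same diagram iff they have the same members.  All notions
-- below depend only on membership.
Diagram : Set
Diagram = List Cell

Positive : Diagram → Set
Positive D = ∀ r c → (r , c) ∈ D → 1 ≤ r × 1 ≤ c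

Northeast : Diagram → Set
Northeast D = ∀ r₁ c₁ r₂ c₂ → (r₁ , c₁) ∈ D → (r₂ , c₂) ∈ D →
  (r₁ ⊔ r₂ , c₁ ⊔ c₂) ∈ D

KohnertMoveAt : Diagram → ℕ → ℕ → ℕ → Diagram → Set
KohnertMoveAt D r c r' E =
  (r , c) ∈ D ×
  (∀ c' → (r , c') ∈ D → c' ≤ c) ×
  1 ≤ r' × r' < r ×
  (r' , c) ∉ D ×
  (∀ r'' → r' < r'' → r'' < r → (r'' , c) ∈ D) ×
  (∀ x → (x ∈ E) ⇔ ((x ∈ D × x ≢ (r , c)) ⊎ x ≡ (r' , c)))

KohnertMove : Diagram → Diagram → Set
KohnertMove D E = ∃[ r ] ∃[ c ] ∃[ r' ] KohnertMoveAt D r c r' E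

EleKohnertMove : Diagram → Diagram → Set
EleKohnertMove D E = ∃[ r ] ∃[ c ] ∃[ r' ] (suc r' ≡ r × KohnertMoveAt D r c r' E)

-- E reachable from D by finitely many (possibly zero) moves.
-- E ∈ 𝒫(D) iff Reach D E; in 𝒫(D), E₂ ≤ E₁ iff Reach E₁ E₂.
Reach : Diagram → Diagram → Set
Reach = Star KohnertMove

ReachEle : Diagram → Diagram → Set
ReachEle = Star EleKohnertMove

{-# OPTIONS --safe #-}

-- Give every cell of D a label that follows it through the moves, where a jump
-- is read as lowering each cell of the jumped block by one row, so that labels
-- keep their order within a column.  Northeastness yields the invariant that a
-- cell starting weakly southeast of another always stays weakly below it.
-- Conversely, such a labelling of E is realised by elementary moves alone:
-- repeatedly lower by one row the lowest cell, rightmost in its row, that has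
-- not yet reached its target; nothing to its right or just below it obstructs.
module Submission where

open import Defs
open import Data.Empty using (⊥-elim)
open import Data.List using ([]; _∷_; filter; map)
open import Data.List.Membership.Propositional using (_∈_; _∉_)
open import Data.List.Membership.Propositional.Properties using (∈-filter⁺; ∈-filter⁻)
open import Data.List.Relation.Unary.Any using (here; there)
open import Data.List.Relation.Unary.Any.Properties using (¬Any[])
open import Data.Nat using (ℕ; zero; suc; _+_; _≤_; _<_; z≤n; s≤s; s≤s⁻¹; _≟_; _<?_; _≤?_)
open import Data.Nat.Induction using (<-wellFounded)
open import Data.Nat.ListAction using (sum)
open import Data.Nat.Properties
open import Data.Product using (_×_; _,_; ∃-syntax; proj₁; proj₂)
open import Data.Product.Properties using (≡-dec)
open import Data.Sum using (_⊎_; inj₁; inj₂; [_,_]′)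
open import Function using (_∘_)
open import Function.Bundles using (_⇔_; mk⇔; Equivalence)
open import Induction.WellFounded using (Acc; acc)
open import Relation.Binary using (tri<; tri≈; tri>)
open import Relation.Binary.Construct.Closure.ReflexiveTransitive as Star using (ε; _◅_)
open import Relation.Binary.PropositionalEquality
open import Relation.Nullary using (¬_; Dec; yes; no; ¬?; contradiction)

-- Columns never change, so a label is a starting position in `D` and `target` records only its
-- current row in `E`; off `D` its values are unconstrained. The field `southeast` is the invariant
-- that makes elementary moves sufficient.
record Labelling (D E : Diagram) : Set where
  field
    target     : ℕ → ℕ → ℕ
    positive   : ∀ {r c} → (r , c) ∈ D → 1 ≤ target r c
    descending : ∀ {r c} → (r , c) ∈ D → target r c ≤ r
    increasing : ∀ {r s c} → (r , c) ∈ D → (s , c) ∈ D → r < s → target r c < target s c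
    southeast  : ∀ {r s c d} → (r , c) ∈ D → (s , d) ∈ D → c < d → s ≤ r →
                 target s d ≤ target r c
    sound      : ∀ {r c} → (r , c) ∈ D → (target r c , c) ∈ E
    complete   : ∀ {h c} → (h , c) ∈ E → ∃[ r ] (r , c) ∈ D × target r c ≡ h

open Labelling

Unfinished : ∀ {D E} → Labelling D E → Set
Unfinished {D} L = ∃[ r ] ∃[ c ] (r , c) ∈ D × target L r c < r

identity : ∀ {D} → Positive D → Labelling D D
identity pos = record
  { target     = λ r _ → r
  ; positive   = λ p → proj₁ (pos _ _ p)
  ; descending = λ _ → ≤-refl
  ; increasing = λ _ _ r<s → r<s
  ; southeast  = λ _ _ _ s≤r → s≤r
  ; sound      = λ p → p
  ; complete   = λ p → _ , p , refl
  }

target-reflects-< : ∀ {D E} (L : Labelling D E) {r s c} → (r , c) ∈ D → (s , c) ∈ D →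
                    target L r c < target L s c → r < s
target-reflects-< L {r} {s} p q lt with <-cmp r s
... | tri< r<s _ _  = r<s
... | tri≈ _ refl _ = contradiction lt (<-irrefl refl)
... | tri> _ _ s<r  = contradiction lt (<-asym (increasing L q p s<r))

-- Kohnert moves preserve labellings

-- Effect on row indices of the move from row hi to row lo of column c.
data Shift (c lo hi : ℕ) : (d h k : ℕ) → Set where
  moved : ∀ {k} → lo ≤ k → k < hi → Shift c lo hi c (suc k) k
  fixed : ∀ {d h} → d ≢ c ⊎ h ≤ lo ⊎ hi < h → Shift c lo hi d h h

module _ {c lo hi : ℕ} where

  shift-total : ∀ d h → ∃[ k ] Shift c lo hi d h k
  shift-total d zero = zero , fixed (inj₂ (inj₁ z≤n))
  shift-total d (suc k) with d ≟ c | lo ≤? k | k <? hi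
  ... | yes refl | yes lo≤k | yes k<hi = k , moved lo≤k k<hi
  ... | no d≢c   | _        | _        = suc k , fixed (inj₁ d≢c)
  ... | yes refl | no lo≰k  | _        = suc k , fixed (inj₂ (inj₁ (≰⇒> lo≰k)))
  ... | yes refl | yes _    | no k≮hi  = suc k , fixed (inj₂ (inj₂ (s≤s (≮⇒≥ k≮hi))))

  moved-not-fixed : ∀ {k} → lo ≤ k → k < hi → ¬ (c ≢ c ⊎ suc k ≤ lo ⊎ hi < suc k)
  moved-not-fixed lo≤k k<hi (inj₁ c≢c)        = c≢c refl
  moved-not-fixed lo≤k k<hi (inj₂ (inj₁ k<lo)) = <⇒≱ k<lo lo≤k
  moved-not-fixed lo≤k k<hi (inj₂ (inj₂ hi≤k)) = <⇒≱ k<hi (s≤s⁻¹ hi≤k)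

  shift-unique : ∀ {d h k l} → Shift c lo hi d h k → Shift c lo hi d h l → k ≡ l
  shift-unique (moved _ _) (moved _ _) = refl
  shift-unique (moved a b) (fixed z)   = ⊥-elim (moved-not-fixed a b z)
  shift-unique (fixed z)   (moved a b) = ⊥-elim (moved-not-fixed a b z)
  shift-unique (fixed _)   (fixed _)   = refl

  shift-≤ : ∀ {d h k} → Shift c lo hi d h k → k ≤ h
  shift-≤ (moved _ _) = n≤1+n _
  shift-≤ (fixed _)   = ≤-refl

  shift-positive : ∀ {d h k} → 1 ≤ lo → Shift c lo hi d h k → 1 ≤ h → 1 ≤ k
  shift-positive 1≤lo (moved lo≤k _) _   = ≤-trans 1≤lo lo≤k
  shift-positive _    (fixed _)      1≤h = 1≤h

  -- The only possible collision is row `suc lo` dropping onto an occupied row `lo`; the first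
  -- premise excludes it, and holds for a move because its landing position is empty.
  shift-increasing : ∀ {d g h k l} → (d ≡ c → g ≢ lo) →
                     Shift c lo hi d g k → Shift c lo hi d h l → g < h → k < l
  shift-increasing _ (moved _ _) (moved _ _) g<h = s≤s⁻¹ g<h
  shift-increasing _ (moved _ _) (fixed _)   g<h = <-trans (n<1+n _) g<h
  shift-increasing _ (fixed _)   (fixed _)   g<h = g<h
  shift-increasing _ (fixed (inj₁ c≢c)) (moved _ _) _ = contradiction refl c≢c
  shift-increasing g≢lo (fixed (inj₂ (inj₁ g≤lo))) (moved lo≤l _) _ =
    <-≤-trans (≤∧≢⇒< g≤lo (g≢lo refl)) lo≤l
  shift-increasing _ (fixed (inj₂ (inj₂ hi<g))) (moved _ l<hi) g<h =
    contradiction (≤-trans (<-trans hi<g g<h) l<hi) (<-irrefl refl)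

  -- The order can break only when the western label drops while an eastern one level with it stays.
  -- The last premise rules out being level when the western label lies in the block.
  shift-southeast : ∀ {d e g h k l} → Shift c lo hi d g k → Shift c lo hi e h l →
                    h ≤ g → (d ≡ c → lo < g → g ≤ hi → h < g) → l ≤ k
  shift-southeast (moved lo≤k k<hi) S _ strict =
    ≤-trans (shift-≤ S) (s≤s⁻¹ (strict refl (s≤s lo≤k) k<hi))
  shift-southeast (fixed _) S h≤g _ = ≤-trans (shift-≤ S) h≤g

module _ {D E F : Diagram} (ne : Northeast D) (L : Labelling D E)
         {hi c lo : ℕ} (move : KohnertMoveAt E hi c lo F) where

  private
    top∈E     = proj₁ move
    rightmost = proj₁ (proj₂ move)
    1≤lo      = proj₁ (proj₂ (proj₂ move))
    lo<hi     = proj₁ (proj₂ (proj₂ (proj₂ move)))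
    lo∉E      = proj₁ (proj₂ (proj₂ (proj₂ (proj₂ move))))
    block     = proj₁ (proj₂ (proj₂ (proj₂ (proj₂ (proj₂ move)))))
    members   = proj₂ (proj₂ (proj₂ (proj₂ (proj₂ (proj₂ move)))))

    shifted : ℕ → ℕ → ℕ
    shifted r d = proj₁ (shift-total {c} {lo} {hi} d (target L r d))

    shifted-is : ∀ r d → Shift c lo hi d (target L r d) (shifted r d)
    shifted-is r d = proj₂ (shift-total d (target L r d))

  block-closed : ∀ {h} → lo < h → h ≤ hi → (h , c) ∈ E
  block-closed {h} lo<h h≤hi with h ≟ hi
  ... | yes refl  = top∈E
  ... | no h≢hi = block h lo<h (≤∧≢⇒< h≤hi h≢hi)

  -- Induction downwards through the block: northeastness puts, above the given
  -- cell and in its column, a cell starting level with the next block cell up.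
  block-southeast-strict : ∀ n {r s d} → (r , c) ∈ D → (s , d) ∈ D → c < d → s ≤ r →
                           lo < target L r c → target L r c + n ≡ hi →
                           target L s d < target L r c
  -- The number `n` counts the rows left up to `hi`. In row `hi` itself, equal targets would put a
  -- cell of `E` to the right of the rightmost one.
  block-southeast-strict zero {r} {s} {d} p q c<d s≤r lo<t t≡hi =
    ≤∧≢⇒< (southeast L p q c<d s≤r) λ eq →
      <⇒≱ c<d (rightmost d (subst (λ h → (h , d) ∈ E) (trans eq t≡hi′) (sound L q)))
    where t≡hi′ = trans (sym (+-identityʳ _)) t≡hi
  block-southeast-strict (suc n) {r} {s} {d} p q c<d s≤r lo<t t+n≡hi
    with complete L (block-closed (m<n⇒m<1+n lo<t)
           (≤-trans (m≤m+n _ n) (≤-reflexive (trans (sym (+-suc _ n)) t+n≡hi))))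
  ... | u , u∈D , tu≡ =
    -- The label of `(s , d)` is strictly below that of `(u , d)`, which by induction is strictly
    -- below that of `(u , c)`, one row above the label of `(r , c)`.
    <-≤-trans (increasing L q above (≤-<-trans s≤r r<u))
      (s≤s⁻¹ (≤-trans (block-southeast-strict n u∈D above c<d ≤-refl
                 (≤-trans (m<n⇒m<1+n lo<t) (≤-reflexive (sym tu≡)))
                 (trans (cong (_+ n) tu≡) (trans (sym (+-suc _ n)) t+n≡hi)))
               (≤-reflexive tu≡)))
    where
    r<u : r < u
    r<u = target-reflects-< L p u∈D (≤-reflexive (sym tu≡))
    above : (u , d) ∈ D
    above = subst (_∈ D)
      (cong₂ _,_ (m≥n⇒m⊔n≡m (≤-trans s≤r (<⇒≤ r<u))) (m≤n⇒m⊔n≡n (<⇒≤ c<d)))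
      (ne u c s d u∈D q)

  -- Lowering rows `suc lo` to `hi` by one occupies row `lo`, where the jumping cell lands, and rows
  -- that the block already fills. As a set this is the single jump.
  shift-sound : ∀ {d h k} → Shift c lo hi d h k → (h , d) ∈ E → (k , d) ∈ F
  shift-sound {k = k} (moved lo≤k k<hi) _ with k ≟ lo
  ... | yes refl = Equivalence.from (members _) (inj₂ refl)
  ... | no k≢lo  = Equivalence.from (members _)
    (inj₁ (block k (≤∧≢⇒< lo≤k (k≢lo ∘ sym)) k<hi , λ eq → <⇒≢ k<hi (cong proj₁ eq)))
  shift-sound (fixed z) h∈E = Equivalence.from (members _) (inj₁ (h∈E , distinct z))
    where
    distinct : ∀ {d h} → d ≢ c ⊎ h ≤ lo ⊎ hi < h → (h , d) ≢ (hi , c)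
    distinct (inj₁ d≢c) refl         = d≢c refl
    distinct (inj₂ (inj₁ h≤lo)) refl = <⇒≱ lo<hi h≤lo
    distinct (inj₂ (inj₂ hi<h)) refl = <-irrefl refl hi<h

  shift-complete : ∀ {d k} → (k , d) ∈ F → ∃[ h ] (h , d) ∈ E × Shift c lo hi d h k
  shift-complete {d} {k} k∈F with Equivalence.to (members _) k∈F
  ... | inj₂ refl = suc lo , block-closed (n<1+n lo) lo<hi , moved ≤-refl lo<hi
  ... | inj₁ (k∈E , k≢hi) with d ≟ c
  ...   | no d≢c = k , k∈E , fixed (inj₁ d≢c)
  ...   | yes refl with <-cmp k hi
  ...     | tri≈ _ refl _ = contradiction refl k≢hi
  ...     | tri> _ _ hi<k = k , k∈E , fixed (inj₂ (inj₂ hi<k))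
  ...     | tri< k<hi _ _ with k ≤? lo
  ...       | yes k≤lo = k , k∈E , fixed (inj₂ (inj₁ k≤lo))
  ...       | no k≰lo  = suc k , block-closed (m<n⇒m<1+n (≰⇒> k≰lo)) k<hi ,
                         moved (<⇒≤ (≰⇒> k≰lo)) k<hi

  -- Northeastness is assumed of the initial `D` only, since moves may destroy it; hence the
  -- invariant compares starting positions, not current ones.
  afterMove : Labelling D F
  afterMove = record
    { target     = shifted
    ; positive   = λ p → shift-positive 1≤lo (shifted-is _ _) (positive L p)
    ; descending = λ p → ≤-trans (shift-≤ (shifted-is _ _)) (descending L p)
    ; increasing = λ p q r<s →
        shift-increasing
          (λ { refl eq → lo∉E (subst (λ h → (h , c) ∈ E) eq (sound L p)) })
          (shifted-is _ _) (shifted-is _ _) (increasing L p q r<s)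
    ; southeast  = λ p q c<d s≤r →
        shift-southeast (shifted-is _ _) (shifted-is _ _) (southeast L p q c<d s≤r)
          (λ { refl lo<t t≤hi → block-southeast-strict _ p q c<d s≤r lo<t (m+[n∸m]≡n t≤hi) })
    ; sound      = λ p → shift-sound (shifted-is _ _) (sound L p)
    ; complete   = complete′
    }
    where
    complete′ : ∀ {k d} → (k , d) ∈ F → ∃[ r ] (r , d) ∈ D × shifted r d ≡ k
    complete′ {k} {d} k∈F with shift-complete k∈F
    ... | h , h∈E , S with complete L h∈E
    ... | r , r∈D , refl = r , r∈D , shift-unique (shifted-is r d) S

  afterMove-unfinished : Unfinished afterMove
  afterMove-unfinished with complete L top∈E
  ... | r , r∈D , refl =
    r , c , r∈D , ≤-trans (drops (shifted-is r c) lo<hi ≤-refl) (descending L r∈D)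
    where
    drops : ∀ {h k} → Shift c lo hi c h k → lo < h → h ≤ hi → k < h
    drops (moved _ _) _ _                     = n<1+n _
    drops (fixed (inj₁ c≢c)) _ _              = contradiction refl c≢c
    drops (fixed (inj₂ (inj₁ h≤lo))) lo<h _   = contradiction h≤lo (<⇒≱ lo<h)
    drops (fixed (inj₂ (inj₂ hi<h))) _ h≤hi   = contradiction h≤hi (<⇒≱ hi<h)

-- Diagrams are lists, so an empty sequence of moves gives equality of lists, not just of members.
-- After at least one move some label has strictly dropped, which leaves an elementary move to make.
reach-labelling : ∀ {D E F} → Northeast D → Labelling D E → Reach E F →
                  E ≡ F ⊎ ∃[ L ] Unfinished {D} {F} L
reach-labelling ne L ε = inj₁ refl
reach-labelling ne L ((_ , _ , _ , m) ◅ ms) with reach-labelling ne (afterMove ne L m) ms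
... | inj₁ refl = inj₂ (afterMove ne L m , afterMove-unfinished ne L m)
... | inj₂ res  = inj₂ res

-- Realising labellings by elementary moves

infix 4 _≟ᶜ_ _≼_

_≟ᶜ_ : (x y : Cell) → Dec (x ≡ y)
_≟ᶜ_ = ≡-dec _≟_ _≟_

-- Columns are compared in reverse, so that a least cell is rightmost among the candidates in its
-- row.
_≼_ : Cell → Cell → Set
(r , c) ≼ (s , d) = r < s ⊎ r ≡ s × d ≤ c

≼-refl : ∀ {x} → x ≼ x
≼-refl = inj₂ (refl , ≤-refl)

≼-trans : ∀ {x y z} → x ≼ y → y ≼ z → x ≼ z
≼-trans (inj₁ p)          (inj₁ q)          = inj₁ (<-trans p q)
≼-trans (inj₁ p)          (inj₂ (refl , _)) = inj₁ p
≼-trans (inj₂ (refl , _)) (inj₁ q)          = inj₁ q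
≼-trans (inj₂ (refl , p)) (inj₂ (refl , q)) = inj₂ (refl , ≤-trans q p)

≼-total : ∀ x y → x ≼ y ⊎ y ≼ x
≼-total (r , c) (s , d) with <-cmp r s | ≤-total c d
... | tri< r<s _ _  | _        = inj₁ (inj₁ r<s)
... | tri> _ _ s<r  | _        = inj₂ (inj₁ s<r)
... | tri≈ _ refl _ | inj₁ c≤d = inj₂ (inj₂ (refl , c≤d))
... | tri≈ _ refl _ | inj₂ d≤c = inj₁ (inj₂ (refl , d≤c))

≼-least : ∀ x xs → ∃[ m ] m ∈ x ∷ xs × (∀ {y} → y ∈ x ∷ xs → m ≼ y)
≼-least x [] = x , here refl , λ { (here refl) → ≼-refl }
≼-least x (y ∷ ys) with ≼-least y ys
... | m , m∈ , m≼ with ≼-total x m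
...   | inj₁ x≼m = x , here refl , λ { (here refl) → ≼-refl ; (there z∈) → ≼-trans x≼m (m≼ z∈) }
...   | inj₂ m≼x = m , there m∈ , λ { (here refl) → m≼x ; (there z∈) → m≼ z∈ }

-- Sum of the rows as a termination measure.

delete : Cell → Diagram → Diagram
delete x = filter (λ y → ¬? (y ≟ᶜ x))

-- This depends on the list, repetitions included. It still drops with each lowering, as all copies
-- of the old cell are deleted and one lower cell is added.
height : Diagram → ℕ
height = sum ∘ map proj₁

height-delete-≤ : ∀ x D → height (delete x D) ≤ height D
height-delete-≤ x [] = z≤n
height-delete-≤ x (y ∷ D) with y ≟ᶜ x
... | yes _ = ≤-trans (height-delete-≤ x D) (m≤n+m _ _)
... | no  _ = +-monoʳ-≤ (proj₁ y) (height-delete-≤ x D)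

height-delete-∈ : ∀ {x D} → x ∈ D → proj₁ x + height (delete x D) ≤ height D
height-delete-∈ {x} {y ∷ D} x∈ with y ≟ᶜ x
height-delete-∈ {x} {y ∷ D} _            | yes refl = +-monoʳ-≤ (proj₁ x) (height-delete-≤ x D)
height-delete-∈ {x} {y ∷ D} (here refl)  | no y≢x   = contradiction refl y≢x
height-delete-∈ {x} {y ∷ D} (there x∈D)  | no _     = begin
  proj₁ x + (proj₁ y + h)  ≡⟨ sym (+-assoc (proj₁ x) (proj₁ y) h) ⟩
  proj₁ x + proj₁ y + h    ≡⟨ cong (_+ h) (+-comm (proj₁ x) (proj₁ y)) ⟩
  proj₁ y + proj₁ x + h    ≡⟨ +-assoc (proj₁ y) (proj₁ x) h ⟩
  proj₁ y + (proj₁ x + h)  ≤⟨ +-monoʳ-≤ (proj₁ y) (height-delete-∈ x∈D) ⟩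
  proj₁ y + height D       ∎
  where
  open ≤-Reasoning
  h = height (delete x D)

-- Lowering the least unfinished cell.

module _ {D E : Diagram} (L : Labelling D E) where

  Moving : Cell → Set
  Moving (r , c) = target L r c < r

  Moving? : ∀ x → Dec (Moving x)
  Moving? (r , c) = target L r c <? r

  unfinished⇒least : Unfinished L →
    ∃[ m ] m ∈ D × Moving m × (∀ {y} → y ∈ D → Moving y → m ≼ y)
  unfinished⇒least (r , c , p , moving) with filter Moving? D in eq
  ... | [] = contradiction (subst ((r , c) ∈_) eq (∈-filter⁺ Moving? p moving)) ¬Any[]
  ... | x ∷ xs with ≼-least x xs
  ...   | m , m∈ , m≼ with ∈-filter⁻ Moving? {xs = D} (subst (m ∈_) (sym eq) m∈)
  ...     | m∈D , m-moving =
    m , m∈D , m-moving , λ y∈D y-moving → m≼ (subst (_ ∈_) eq (∈-filter⁺ Moving? y∈D y-moving))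

  unfinished? : Dec (Unfinished L)
  unfinished? with filter Moving? D in eq
  ... | [] = no λ { (r , c , p , moving) →
               ¬Any[] (subst ((r , c) ∈_) eq (∈-filter⁺ Moving? p moving)) }
  ... | (r , c) ∷ _ with ∈-filter⁻ Moving? {xs = D} (subst ((r , c) ∈_) (sym eq) (here refl))
  ...   | p , moving = yes (r , c , p , moving)

  stationary : ¬ Unfinished L → ∀ {r c} → (r , c) ∈ D → target L r c ≡ r
  stationary done p = ≤-antisym (descending L p) (≮⇒≥ λ lt → done (_ , _ , p , lt))

  finished : ¬ Unfinished L → ∀ x → x ∈ D ⇔ x ∈ E
  finished done (h , c) = mk⇔
    (λ p → subst (λ r → (r , c) ∈ E) (stationary done p) (sound L p))
    from
    where
    from : (h , c) ∈ E → (h , c) ∈ D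
    from h∈E with complete L h∈E
    ... | r , p , refl = subst (λ k → (k , c) ∈ D) (sym (stationary done p)) p

  module LowerLeast {r c : ℕ} (top∈D : (suc r , c) ∈ D) (top-moving : Moving (suc r , c))
                    (least : ∀ {y} → y ∈ D → Moving y → (suc r , c) ≼ y) where

    lowered : Diagram
    lowered = (r , c) ∷ delete (suc r , c) D

    lower-cells-stationary : ∀ {s d} → (s , d) ∈ D → s ≤ r → target L s d ≡ s
    lower-cells-stationary p s≤r = ≤-antisym (descending L p) (≮⇒≥ λ lt →
      [ (λ r<s → <⇒≱ r<s (≤-trans s≤r (n≤1+n r)))
      , (λ { (refl , _) → 1+n≰n s≤r }) ]′ (least p lt))

    -- A cell there would have target `r` by leastness, forcing the cell above it to have target at
    -- least `suc r`, although that cell must still descend.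
    vacant : (r , c) ∉ D
    vacant p = <⇒≱ top-moving
      (≤-trans (s≤s (≤-reflexive (sym (lower-cells-stationary p ≤-refl))))
               (increasing L p top∈D (n<1+n r)))

    -- By `southeast` in the case of equal rows, a cell further right would also have to descend,
    -- and it would precede the least one.
    rightmost : ∀ d → (suc r , d) ∈ D → d ≤ c
    rightmost d p = ≮⇒≥ λ c<d →
      [ <-irrefl refl , (λ { (_ , d≤c) → <⇒≱ c<d d≤c }) ]′
        (least p (≤-<-trans (southeast L top∈D p c<d ≤-refl) top-moving))

    members : ∀ x → x ∈ lowered ⇔ ((x ∈ D × x ≢ (suc r , c)) ⊎ x ≡ (r , c))
    members x = mk⇔
      (λ { (here eq) → inj₂ eq ; (there p) → inj₁ (∈-filter⁻ _ {xs = D} p) })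
      (λ { (inj₁ (p , ne)) → there (∈-filter⁺ _ p ne) ; (inj₂ eq) → here eq })

    height-decreases : height lowered < height D
    -- For the cell `(suc r , c)` the left side of this bound computes to `suc (height lowered)`.
    height-decreases = height-delete-∈ top∈D

    -- The freedom in `F` lets the last move end at the prescribed list rather than at another list
    -- with the same members.
    moveTo : ∀ F → (∀ x → x ∈ lowered ⇔ x ∈ F) → EleKohnertMove D F
    moveTo F same = suc r , c , r , refl , top∈D , rightmost ,
      ≤-trans (positive L top∈D) (s≤s⁻¹ top-moving) , n<1+n r , vacant ,
      (λ s r<s s≤r → contradiction (s≤s⁻¹ s≤r) (<⇒≱ r<s)) ,
      λ x → mk⇔ (Equivalence.to (members x) ∘ Equivalence.from (same x))
                (Equivalence.to (same x) ∘ Equivalence.from (members x))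

    private
      -- Carrying the new target as an index lets each field of the new labelling be proved by
      -- matching on whether the cell was just lowered.
      data Origin (s d : ℕ) : ℕ → Set where
        new : s ≡ r → d ≡ c → Origin s d (target L (suc r) c)
        old : (s , d) ∈ D → (s , d) ≢ (suc r , c) → Origin s d (target L s d)

      newTarget : ℕ → ℕ → ℕ
      newTarget s d with (s , d) ≟ᶜ (r , c)
      ... | yes _ = target L (suc r) c
      ... | no  _ = target L s d

      origin : ∀ {s d} → (s , d) ∈ lowered → Origin s d (newTarget s d)
      origin {s} {d} p with (s , d) ≟ᶜ (r , c) | Equivalence.to (members _) p
      ... | yes eq | _               = new (cong proj₁ eq) (cong proj₂ eq)
      ... | no _   | inj₁ (q , ne)   = old q ne
      ... | no ne  | inj₂ eq         = contradiction eq ne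

      newTarget-new : newTarget r c ≡ target L (suc r) c
      newTarget-new with (r , c) ≟ᶜ (r , c)
      ... | yes _ = refl
      ... | no ne = contradiction refl ne

      newTarget-old : ∀ {s d} → (s , d) ∈ D → newTarget s d ≡ target L s d
      newTarget-old {s} {d} p with (s , d) ≟ᶜ (r , c)
      ... | yes refl = contradiction p vacant
      ... | no _     = refl

      positive′ : ∀ {s d h} → Origin s d h → 1 ≤ h
      positive′ (new _ _) = positive L top∈D
      positive′ (old p _) = positive L p

      descending′ : ∀ {s d h} → Origin s d h → h ≤ s
      descending′ (new refl _) = s≤s⁻¹ top-moving
      descending′ (old p _)    = descending L p

      increasing′ : ∀ {s t d h k} → Origin s d h → Origin t d k → s < t → h < k
      increasing′ (new refl _) (new refl _) s<t = contradiction s<t (<-irrefl refl)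
      -- The position `(suc r , c)` has been vacated, so `t` lies strictly above `suc r` and the old
      -- order applies.
      increasing′ (new refl refl) (old q t≢) r<t =
        increasing L top∈D q (≤∧≢⇒< r<t λ { refl → t≢ refl })
      increasing′ (old p _) (new refl refl) s<r = increasing L p top∈D (m<n⇒m<1+n s<r)
      increasing′ (old p _) (old q _) s<t = increasing L p q s<t

      southeast′ : ∀ {s t d e h k} → Origin s d h → Origin t e k → d < e → t ≤ s → k ≤ h
      southeast′ (new _ refl) (new _ refl) d<e _ = contradiction d<e (<-irrefl refl)
      southeast′ (new refl refl) (old q _) d<e t≤r =
        southeast L top∈D q d<e (≤-trans t≤r (n≤1+n r))
      -- Lowering creates a new southeast pair when `s` is `r`. The western cell is then stationary
      -- with target `r`, and the lowered one has target at most `r`.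
      southeast′ {s} (old p _) (new refl refl) d<e r≤s with s ≟ r
      ... | yes refl = ≤-trans (s≤s⁻¹ top-moving)
                               (≤-reflexive (sym (lower-cells-stationary p ≤-refl)))
      ... | no s≢r   = southeast L p top∈D d<e (≤∧≢⇒< r≤s (s≢r ∘ sym))
      southeast′ (old p _) (old q _) d<e t≤s = southeast L p q d<e t≤s

      sound′ : ∀ {s d h} → Origin s d h → (h , d) ∈ E
      sound′ (new refl refl) = sound L top∈D
      sound′ (old p _)       = sound L p

      complete′ : ∀ {h d} → (h , d) ∈ E → ∃[ s ] (s , d) ∈ lowered × newTarget s d ≡ h
      complete′ {h} {d} h∈E with complete L h∈E
      ... | s , p , refl with (s , d) ≟ᶜ (suc r , c)
      ...   | yes refl = r , here refl , newTarget-new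
      ...   | no ne    = s , Equivalence.from (members _) (inj₁ (p , ne)) , newTarget-old p

    labelling : Labelling lowered E
    labelling = record
      { target     = newTarget
      ; positive   = λ p → positive′ (origin p)
      ; descending = λ p → descending′ (origin p)
      ; increasing = λ p q → increasing′ (origin p) (origin q)
      ; southeast  = λ p q → southeast′ (origin p) (origin q)
      ; sound      = λ p → sound′ (origin p)
      ; complete   = complete′
      }

-- Iterating the lowering, and the theorem.

labelling⇒reachEle : ∀ {D E} (L : Labelling D E) → Unfinished L → ReachEle D E
labelling⇒reachEle {D} L = go L (<-wellFounded (height D))
  where
  go : ∀ {D E} (L : Labelling D E) → Acc _<_ (height D) → Unfinished L → ReachEle D E
  go {D} {E} L (acc rec) unfinished with unfinished⇒least L unfinished
  ... | (suc r , c) , top∈D , top-moving , least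
      with unfinished? (LowerLeast.labelling L top∈D top-moving least)
  ...   | yes unfinished′ = moveTo lowered (λ _ → mk⇔ (λ p → p) (λ p → p)) ◅
                            go labelling (rec height-decreases) unfinished′
    where open LowerLeast L top∈D top-moving least
  -- Here `lowered` and `E` have the same members, so this final move is aimed at `E` itself.
  ...   | no done = moveTo E (finished labelling done) ◅ ε
    where open LowerLeast L top∈D top-moving least

theorem1p2 : (D : Diagram) → Positive D → Northeast D →
    ((E : Diagram) → Reach D E → ReachEle D E) ×
    ((E : Diagram) → ReachEle D E → Reach D E) ×
    ((E₁ E₂ : Diagram) → ReachEle D E₁ → ReachEle D E₂ →
    ReachEle E₁ E₂ → Reach E₁ E₂)
theorem1p2 D pos ne = elementary , (λ _ → forget) , (λ _ _ _ _ → forget)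
  where
  forget : ∀ {E F} → ReachEle E F → Reach E F
  forget = Star.map λ { (r , c , r' , _ , move) → r , c , r' , move }

  elementary : ∀ E → Reach D E → ReachEle D E
  elementary E reach with reach-labelling ne (identity pos) reach
  ... | inj₁ refl             = ε
  ... | inj₂ (L , unfinished) = labelling⇒reachEle L unfinished
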